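{- Let $k\geq 2$ be any natural number. Then $n(k,3)=2k+1$.
   Context: $S_n$ and $A_n$ denote the symmetric and alternating groups on $n$ letters. For natural numbers $k,l\geq 2$ such that $l$ is odd or $k$ is even, $n(k,l)$ denotes the largest natural number $n$ such that every element of $A_n$ can be written as a product of $k$ (not necessarily distinct) $l$-cycles of $S_n$; equivalently, the largest $n$ such that $C_l^k=A_n$, where $C_l$ is the set of all $l$-cycles in $S_n$ and $C_l^k=\{x_1x_2\cdots x_k \mid x_i\in C_l\}$. -}

module Defs where

open import Data.Fin.Base using (Fin; toℕ)
open import Data.Fin.Permutation using (Permutation′; _⟨$⟩ʳ_; _≈_; _∘ₚ_; id)
open import Data.Fin.Permutation.Transposition.List using (TranspositionList; eval)
open import Data.List.Base using (length)
open import Data.List.Relation.Unary.All as List using ()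
open import Data.Nat.Base using (ℕ; suc; _≤_)
open import Data.Nat.Divisibility using (_∣_)
open import Data.Nat.DivMod using (_mod_)
open import Data.Nat.Properties using (≤-antisym)
open import Data.Product.Base using (_×_; _,_; ∃-syntax)
open import Data.Vec.Base using (Vec; foldr′)
open import Data.Vec.Relation.Unary.All as Vec using ()
open import Function.Definitions using (Injective)
open import Level using (0ℓ)
open import Relation.Binary.PropositionalEquality.Core using (_≡_; _≢_)
open import Relation.Unary using (Pred; _⊆_)

private
  variable
    n : ℕ

-- `eval` also accepts degenerate pairs (i , i), which denote the identity;
-- they must be excluded for the parity of the length to be meaningful.
Alternating : (n : ℕ) → Pred (Permutation′ n) 0ℓ
Alternating n π =
  ∃[ ts ] List.All (λ (i , j) → i ≢ j) ts × 2 ∣ length ts × eval {n} ts ≈ π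

next : ∀ {l} → Fin l → Fin l
next {suc l} i = suc (toℕ i) mod suc l

-- The cycle (a 0, a 1, …, a (l - 1)).
IsCycle : (l : ℕ) → Pred (Permutation′ n) 0ℓ
IsCycle {n} l π = ∃[ a ]
    Injective {A = Fin l} {B = Fin n} _≡_ _≡_ a
  × (∀ i → π ⟨$⟩ʳ a i ≡ a (next i))
  × (∀ x → (∀ i → x ≢ a i) → π ⟨$⟩ʳ x ≡ x)

-- `_∘ₚ_` composes left to right. Since the factors below range over all
-- l-cycles, the opposite convention gives the same set of products.
product : ∀ {k} → Vec (Permutation′ n) k → Permutation′ n
product = foldr′ _∘ₚ_ id

-- C_l^k inside the symmetric group on n letters.
CyclePower : (k l n : ℕ) → Pred (Permutation′ n) 0ℓ
CyclePower k l n π =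
  ∃[ xs ] Vec.All (IsCycle l) {k} xs × product xs ≈ π

IsLargest : Pred ℕ 0ℓ → Pred ℕ 0ℓ
IsLargest P m = P m × (∀ n → P n → n ≤ m)

IsLargest-unique : ∀ (P : Pred ℕ 0ℓ) {m m′} → IsLargest P m → IsLargest P m′ → m ≡ m′
IsLargest-unique P (p , max) (p′ , max′) = ≤-antisym (max′ _ p) (max _ p′)

-- `n⟨ k , l ⟩≡ m` says that n(k,l) exists and equals m. It is intended for
-- k, l ≥ 2 with l odd or k even; the inclusion of CyclePower k l n in
-- Alternating n is then automatic.
n⟨_,_⟩≡_ : (k l m : ℕ) → Set
n⟨ k , l ⟩≡ m = IsLargest (λ n → Alternating n ⊆ CyclePower k l n) m

{-# OPTIONS --safe #-}

-- Upper bound: view k 3-cycles as 2k edges on n > 2k + 1 points; the resulting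
-- graph is disconnected, so some nonconstant labelling f is invariant under all
-- the factors. This is absurd if the product is an n-cycle (n odd). If n is even,
-- take the product of (0 1) with a cycle on the remaining points: f must separate
-- {0 , 1} from the rest, no factor fits inside {0 , 1}, and hence 0 is fixed.
--
-- Lower bound: by induction on k. An even permutation of an odd number n ≥ 5 of
-- points agrees with a 3-cycle at two points, so multiplying it by a 3-cycle fixes
-- two points, and it restricts to an even permutation of n - 2 points.

module Submission where

open import Defs
import Algebra.Properties.CommutativeMonoid.Sum
open import Data.Bool.Base using (Bool; true; false; if_then_else_)
open import Data.Fin.Base using (Fin; zero; suc; inject₁; punchIn; punchOut)
open import Data.Fin.Patterns using (0F; 1F; 2F)
open import Data.Fin.Permutation
  using (Permutation′; _⟨$⟩ʳ_; _⟨$⟩ˡ_; _≈_; _∘ₚ_; id; flip; transpose; insert; insert-punchIn;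
         inverseˡ; inverseʳ)
import Data.Fin.Permutation.Components as PC
open import Data.Fin.Permutation.Transposition.List using (TranspositionList; eval; lift₀; eval-lift)
open import Data.Fin.Properties
  using (_≟_; _<?_; <-cmp; any?; ¬∀⟶∃¬; injective⇒≤; suc-injective; punchIn-injective; punchInᵢ≢i;
         punchIn-punchOut; punchOut-cong; punchOut-punchIn)
open import Data.List.Base using (List; []; _∷_; length)
open import Data.List.Membership.DecPropositional using (_∈?_)
open import Data.List.Membership.Propositional using (_∈_; _∉_)
open import Data.List.Membership.Setoid.Properties using (index-injective)
open import Data.List.Properties using (length-map)
open import Data.List.Relation.Unary.All as List using ([]; _∷_)
import Data.List.Relation.Unary.All.Properties as List
open import Data.List.Relation.Unary.Any as Any using (here; there)
open import Data.Nat.Base using (ℕ; _≤_; _<_; _+_; _*_; zero; suc; parity; s≤s; z≤n)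
open import Data.Nat.Divisibility using (_∣_; divides; ∣-refl; ∣m∣n⇒∣m+n)
open import Data.Nat.Properties
  using (_≤?_; +-0-commutativeMonoid; +-comm; *-comm; *-monoˡ-≤; m≤m+n; m≤n⇒m≤1+n; ≤-refl;
         ≤-reflexive; ≤-trans; ≤⇒≯; ≰⇒>)
open import Data.Parity.Base as ℙ using (Parity; 0ℙ; 1ℙ; _⁻¹)
open import Data.Parity.Properties
  using (+-homo-+; p+p≡0ℙ; suc-homo-⁻¹; ⁻¹-involutive; ⁻¹-selfInverse)
open import Data.Product.Base using (_×_; _,_; ∃-syntax; Σ-syntax)
open import Data.Sum.Base using (_⊎_; inj₁; inj₂)
open import Data.Vec.Base as Vec using (Vec; []; _∷_)
open import Data.Vec.Relation.Unary.All as VecAll using ([]; _∷_)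
import Data.Vec.Relation.Unary.All.Properties as VecAll
open import Function.Base using (_∘_)
open import Function.Bundles using (Injection)
open import Function.Definitions using (Injective)
open import Function.Properties.Inverse using (↔⇒↣)
open import Relation.Binary.Definitions using (tri<; tri≈; tri>)
open import Relation.Binary.PropositionalEquality
open import Relation.Nullary using (Dec; yes; no; ¬_; ¬?; contradiction; does)
open import Relation.Nullary.Decidable using (dec-true; dec-false; decidable-stable)

open Algebra.Properties.CommutativeMonoid.Sum +-0-commutativeMonoid
  using (sum; sum-cong-≗; sum-permute; ∑-distrib-+)

private
  variable
    k l m n : ℕ
    p : Parity
    π ρ : Permutation′ n

-- Transpositions

perm-injective : (π : Permutation′ n) → Injective _≡_ _≡_ (π ⟨$⟩ʳ_)
perm-injective π = Injection.injective (↔⇒↣ π)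

transpose-left : (i j : Fin n) → PC.transpose i j i ≡ j
transpose-left i j with i ≟ i
... | yes _   = refl
... | no i≢i = contradiction refl i≢i

transpose-right : (i j : Fin n) → PC.transpose i j j ≡ i
transpose-right i j with j ≟ i
... | yes j≡i = j≡i
... | no _ with j ≟ j
...   | yes _   = refl
...   | no j≢j = contradiction refl j≢j

transpose-fix : {i j k : Fin n} → k ≢ i → k ≢ j → PC.transpose i j k ≡ k
transpose-fix {i = i} {j} {k} k≢i k≢j with k ≟ i
... | yes k≡i = contradiction k≡i k≢i
... | no _ with k ≟ j
...   | yes k≡j = contradiction k≡j k≢j
...   | no _    = refl

-- For a permutation `f` this is the rule for conjugating a transposition; for `f = punchIn x` it
-- carries a transposition into a set with one more point.
transpose-injective : (f : Fin m → Fin n) → Injective _≡_ _≡_ f → ∀ i j k →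
                      f (PC.transpose i j k) ≡ PC.transpose (f i) (f j) (f k)
transpose-injective f f-inj i j k with k ≟ i
... | yes refl = sym (transpose-left (f i) (f j))
... | no k≢i with k ≟ j
...   | yes refl = sym (transpose-right (f i) (f j))
...   | no k≢j  = sym (transpose-fix (k≢i ∘ f-inj) (k≢j ∘ f-inj))

transpose-comm : (i j k : Fin n) → PC.transpose i j k ≡ PC.transpose j i k
transpose-comm i j k = go (k ≟ i) (k ≟ j)
  where
  go : Dec (k ≡ i) → Dec (k ≡ j) → PC.transpose i j k ≡ PC.transpose j i k
  go (yes refl) _          = trans (transpose-left k j) (sym (transpose-right j k))
  go (no _)     (yes refl) = trans (transpose-right i k) (sym (transpose-left k i))
  go (no k≢i)   (no k≢j)   = trans (transpose-fix k≢i k≢j) (sym (transpose-fix k≢j k≢i))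

transpose-perm : (π : Permutation′ n) → ∀ i j k →
  π ⟨$⟩ʳ PC.transpose i j k ≡ PC.transpose (π ⟨$⟩ʳ i) (π ⟨$⟩ʳ j) (π ⟨$⟩ʳ k)
transpose-perm π = transpose-injective (π ⟨$⟩ʳ_) (perm-injective π)

-- Permutations with a prescribed fixed point

data PunchView (x : Fin (suc n)) : Fin (suc n) → Set where
  hole    : PunchView x x
  punched : ∀ i → PunchView x (punchIn x i)

punchView : ∀ x (i : Fin (suc n)) → PunchView x i
punchView x i with x ≟ i
... | yes refl = hole
... | no x≢i  = subst (PunchView x) (punchIn-punchOut x≢i) (punched (punchOut x≢i))

extend : Fin (suc n) → Permutation′ n → Permutation′ (suc n)
extend x = insert x x

extend-hole : ∀ x (ρ : Permutation′ n) → extend x ρ ⟨$⟩ʳ x ≡ x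
extend-hole x ρ with x ≟ x
... | yes _   = refl
... | no x≢x = contradiction refl x≢x

extend-punched : ∀ x (ρ : Permutation′ n) i → extend x ρ ⟨$⟩ʳ punchIn x i ≡ punchIn x (ρ ⟨$⟩ʳ i)
extend-punched x = insert-punchIn x x

≈-extend : ∀ {x} {ρ : Permutation′ n} (π : Permutation′ (suc n)) → π ⟨$⟩ʳ x ≡ x →
           (∀ i → π ⟨$⟩ʳ punchIn x i ≡ punchIn x (ρ ⟨$⟩ʳ i)) → π ≈ extend x ρ
≈-extend {x = x} {ρ} π πx πp i with punchView x i
... | hole      = trans πx (sym (extend-hole x ρ))
... | punched j = trans (πp j) (sym (extend-punched x ρ j))

transpose-extend : ∀ x i j (ρ : Permutation′ n) →
  transpose (punchIn x i) (punchIn x j) ∘ₚ extend x ρ ≈ extend x (transpose i j ∘ₚ ρ)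
transpose-extend x i j ρ = ≈-extend (transpose (punchIn x i) (punchIn x j) ∘ₚ extend x ρ)
  (trans (cong (extend x ρ ⟨$⟩ʳ_)
           (transpose-fix (punchInᵢ≢i x i ∘ sym) (punchInᵢ≢i x j ∘ sym)))
         (extend-hole x ρ))
  λ k → trans (cong (extend x ρ ⟨$⟩ʳ_)
                (sym (transpose-injective (punchIn x) (punchIn-injective x _ _) i j k)))
              (extend-punched x ρ _)

-- Parity, and deletion of a fixed point

-- The parity of the length of some factorisation into genuine transpositions. Each constructor
-- carries its own `≈`, since permutations are compared pointwise.
data HasSign {n : ℕ} : Parity → Permutation′ n → Set where
  even-id : π ≈ id → HasSign 0ℙ π
  swap    : ∀ {i j} → i ≢ j → HasSign p ρ → π ≈ transpose i j ∘ₚ ρ → HasSign (p ⁻¹) π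

eval-sign : (ts : TranspositionList n) → List.All (λ (i , j) → i ≢ j) ts →
            HasSign (parity (length ts)) (eval ts)
eval-sign []       []         = even-id λ _ → refl
eval-sign (t ∷ ts) (i≢j ∷ nd) =
  subst (λ p → HasSign p (eval (t ∷ ts))) (⁻¹-selfInverse (suc-homo-⁻¹ (length ts)))
    (swap i≢j (eval-sign ts nd) λ _ → refl)

HasSign-resp-≈ : π ≈ ρ → HasSign p π → HasSign p ρ
HasSign-resp-≈ π≈ρ (even-id π≈)     = even-id λ i → trans (sym (π≈ρ i)) (π≈ i)
HasSign-resp-≈ π≈ρ (swap i≢j s π≈) = swap i≢j s λ i → trans (sym (π≈ρ i)) (π≈ i)

parity-even : ∀ {n} → 2 ∣ n → parity n ≡ 0ℙ
parity-even (divides q refl) = go q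
  where
  go : ∀ q → parity (q * 2) ≡ 0ℙ
  go zero    = refl
  go (suc q) = go q

Alternating⇒even : Alternating n π → HasSign 0ℙ π
Alternating⇒even (ts , nd , 2∣ts , ts≈π) =
  HasSign-resp-≈ ts≈π (subst (λ p → HasSign p (eval ts)) (parity-even 2∣ts) (eval-sign ts nd))

-- Obtained from a product of transpositions by moving x into at most one leading factor.
data Isolated {n} (x : Fin (suc n)) (p : Parity) (π : Permutation′ (suc n)) : Set where
  fixing : HasSign p ρ → π ≈ extend x ρ → Isolated x p π
  moving : ∀ a → HasSign (p ⁻¹) ρ → π ≈ transpose x (punchIn x a) ∘ₚ extend x ρ → Isolated x p π

HasSign-⁻¹⁻¹ : HasSign p π → HasSign (p ⁻¹ ⁻¹) π
HasSign-⁻¹⁻¹ {p = p} {π = π} = subst (λ q → HasSign q π) (sym (⁻¹-involutive p))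

-- Two leading transpositions through `x` merge into at most one. If they are equal, they cancel;
-- otherwise, conjugating the transposition of `x` and `j` by that of `x` and `a` gives the
-- transposition of `a` and `j`, which avoids `x` and is absorbed into the remaining part.
isolate-hole : ∀ {x} j → Isolated x p ρ → π ≈ transpose x (punchIn x j) ∘ₚ ρ → Isolated x (p ⁻¹) π
isolate-hole j (fixing s ρ≈) π≈ = moving j (HasSign-⁻¹⁻¹ s) λ i → trans (π≈ i) (ρ≈ _)
isolate-hole {x = x} j (moving {ρ = τ} a s ρ≈) π≈ with a ≟ j
... | yes refl = fixing s λ i → trans (π≈ i) (trans (ρ≈ _) (cong (extend x τ ⟨$⟩ʳ_)
                   (trans (cong (PC.transpose x (punchIn x j)) (transpose-comm x (punchIn x j) i))
                          (PC.transpose-inverse x (punchIn x j)))))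
... | no a≢j = moving a (swap {π = transpose a j ∘ₚ τ} a≢j s λ _ → refl) λ i →
  trans (π≈ i) (trans (ρ≈ _) (trans (cong (extend x τ ⟨$⟩ʳ_) (conj i)) (transpose-extend x a j τ _)))
  where
  conj : ∀ i → PC.transpose x (punchIn x a) (PC.transpose x (punchIn x j) i)
             ≡ PC.transpose (punchIn x a) (punchIn x j) (PC.transpose x (punchIn x a) i)
  conj i = trans (transpose-perm (transpose x (punchIn x a)) x (punchIn x j) i)
    (cong₂ (λ u v → PC.transpose u v (PC.transpose x (punchIn x a) i))
      (transpose-left x _)
      (transpose-fix (punchInᵢ≢i x j) (a≢j ∘ sym ∘ punchIn-injective x j a)))

-- Induction on the factorisation, moving each new leading transposition past the one that involves
-- `x`.
isolate : ∀ x {π : Permutation′ (suc n)} → HasSign p π → Isolated x p π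
isolate x {π} (even-id π≈) = fixing (even-id {π = id} λ _ → refl) (≈-extend π (π≈ x) λ _ → π≈ _)
isolate x (swap {ρ = σ} {i = i} {j} i≢j s π≈) with punchView x i | punchView x j
... | hole       | hole       = contradiction refl i≢j
... | hole       | punched j′ = isolate-hole j′ (isolate x s) π≈
... | punched i′ | hole       = isolate-hole i′ (isolate x s)
  λ k → trans (π≈ k) (cong (σ ⟨$⟩ʳ_) (transpose-comm (punchIn x i′) x k))
... | punched i′ | punched j′ with isolate x s
...   | fixing {ρ = τ} s′ ρ≈   =
  fixing (swap {π = transpose i′ j′ ∘ₚ τ} (i≢j ∘ cong (punchIn x)) s′ λ _ → refl)
  λ k → trans (π≈ k) (trans (ρ≈ _) (transpose-extend x i′ j′ τ k))
...   | moving {ρ = τ} a s′ ρ≈ =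
  -- The transposition of `i′` and `j′` changes places with that of `x` and `a`; conjugation
  -- replaces `a` by its image.
  moving (PC.transpose i′ j′ a) (swap {π = transpose i′ j′ ∘ₚ τ} (i≢j ∘ cong (punchIn x)) s′ λ _ → refl)
  λ k → trans (π≈ k) (trans (ρ≈ _) (trans (cong (extend x τ ⟨$⟩ʳ_) (conj k))
          (transpose-extend x i′ j′ τ _)))
  where
  P = punchIn x
  t = transpose (P i′) (P j′)
  conj : ∀ k → PC.transpose x (P a) (PC.transpose (P i′) (P j′) k)
             ≡ PC.transpose (P i′) (P j′) (PC.transpose x (P (PC.transpose i′ j′ a)) k)
  conj k = sym (trans (transpose-perm t x (P (PC.transpose i′ j′ a)) k)
    (cong₂ (λ u v → PC.transpose u v (t ⟨$⟩ʳ k))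
      (transpose-fix (punchInᵢ≢i x i′ ∘ sym) (punchInᵢ≢i x j′ ∘ sym))
      (trans (cong (t ⟨$⟩ʳ_) (transpose-injective P (punchIn-injective x _ _) i′ j′ a))
             (trans (cong (t ⟨$⟩ʳ_) (transpose-comm (P i′) (P j′) (P a)))
                    (PC.transpose-inverse (P i′) (P j′))))))

-- The `moving` form sends `x` to `punchIn x (ρ ⟨$⟩ʳ a)`, which is never `x`. So a permutation
-- fixing `x` is in the `fixing` form, where the parity is already that of a permutation of the
-- other points.
restrict : ∀ x {π : Permutation′ (suc n)} → HasSign p π → π ⟨$⟩ʳ x ≡ x →
           ∃[ ρ ] HasSign p ρ × π ≈ extend x ρ
restrict x {π} s πx with isolate x s
... | fixing s′ π≈ = _ , s′ , π≈
... | moving {ρ = ρ} a s′ π≈ = contradiction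
  (trans (sym (trans (cong (extend x ρ ⟨$⟩ʳ_) (transpose-left x (punchIn x a)))
              (extend-punched x ρ a)))
         (trans (sym (π≈ x)) πx))
  (punchInᵢ≢i x (ρ ⟨$⟩ʳ a))

-- 3-cycles

-- Sends `a` to `b`, `b` to `c` and `c` to `a`. As a product of two transpositions it preserves
-- parity by two uses of `swap`.
threeCycle : Fin n → Fin n → Fin n → Permutation′ n
threeCycle a b c = transpose a b ∘ₚ transpose a c

isCycle₃ : ∀ {a b c} → a ≢ b → b ≢ c → c ≢ a →
           π ⟨$⟩ʳ a ≡ b → π ⟨$⟩ʳ b ≡ c → π ⟨$⟩ʳ c ≡ a →
           (∀ x → x ≢ a → x ≢ b → x ≢ c → π ⟨$⟩ʳ x ≡ x) → IsCycle {n} 3 π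
isCycle₃ {n} {π} {a} {b} {c} a≢b b≢c c≢a πa πb πc fix =
  orbit , orbit-injective , step , λ x ∉ → fix x (∉ 0F) (∉ 1F) (∉ 2F)
  where
  orbit : Fin 3 → Fin n
  orbit 0F = a
  orbit 1F = b
  orbit 2F = c

  orbit-injective : Injective _≡_ _≡_ orbit
  orbit-injective {0F} {0F} _  = refl
  orbit-injective {0F} {1F} eq = contradiction eq a≢b
  orbit-injective {0F} {2F} eq = contradiction (sym eq) c≢a
  orbit-injective {1F} {0F} eq = contradiction (sym eq) a≢b
  orbit-injective {1F} {1F} _  = refl
  orbit-injective {1F} {2F} eq = contradiction eq b≢c
  orbit-injective {2F} {0F} eq = contradiction eq c≢a
  orbit-injective {2F} {1F} eq = contradiction (sym eq) b≢c
  orbit-injective {2F} {2F} _  = refl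

  step : ∀ i → π ⟨$⟩ʳ orbit i ≡ orbit (next i)
  step 0F = πa
  step 1F = πb
  step 2F = πc

flip-moves : (π : Permutation′ n) → ∀ {i j} → π ⟨$⟩ʳ i ≡ j → π ⟨$⟩ˡ j ≡ i
flip-moves π eq = trans (cong (π ⟨$⟩ˡ_) (sym eq)) (inverseˡ π)

flip-cycle₃ : (π : Permutation′ n) → IsCycle 3 π → IsCycle 3 (flip π)
flip-cycle₃ π (a , a-inj , step , fix) = isCycle₃ {π = flip π} {a 0F} {a 2F} {a 1F}
  ((λ ()) ∘ a-inj) ((λ ()) ∘ a-inj) ((λ ()) ∘ a-inj)
  (flip-moves π (step 2F)) (flip-moves π (step 1F)) (flip-moves π (step 0F))
  λ x x≢0 x≢2 x≢1 → flip-moves π (fix x λ { 0F → x≢0 ; 1F → x≢1 ; 2F → x≢2 })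

module _ {a b c : Fin n} (a≢b : a ≢ b) (b≢c : b ≢ c) (c≢a : c ≢ a) where

  threeCycle-a : threeCycle a b c ⟨$⟩ʳ a ≡ b
  threeCycle-a = trans (cong (PC.transpose a c) (transpose-left a b)) (transpose-fix (a≢b ∘ sym) b≢c)

  threeCycle-b : threeCycle a b c ⟨$⟩ʳ b ≡ c
  threeCycle-b = trans (cong (PC.transpose a c) (transpose-right a b)) (transpose-left a c)

  threeCycle-c : threeCycle a b c ⟨$⟩ʳ c ≡ a
  threeCycle-c = trans (cong (PC.transpose a c) (transpose-fix c≢a (b≢c ∘ sym))) (transpose-right a c)

  threeCycle-fix : ∀ x → x ≢ a → x ≢ b → x ≢ c → threeCycle a b c ⟨$⟩ʳ x ≡ x
  threeCycle-fix x x≢a x≢b x≢c =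
    trans (cong (PC.transpose a c) (transpose-fix x≢a x≢b)) (transpose-fix x≢a x≢c)

  threeCycle-isCycle : IsCycle 3 (threeCycle a b c)
  threeCycle-isCycle = isCycle₃ {π = threeCycle a b c} a≢b b≢c c≢a
    threeCycle-a threeCycle-b threeCycle-c threeCycle-fix

-- A 3-cycle has order 3. This lets one 3-cycle be traded for a product of two.
cycle₃-inverse² : (π : Permutation′ n) → IsCycle 3 π → ∀ x → π ⟨$⟩ˡ (π ⟨$⟩ˡ x) ≡ π ⟨$⟩ʳ x
cycle₃-inverse² π (a , a-inj , step , fix) x with any? (λ i → x ≟ a i)
... | no ∄  = let πx = fix x λ i x≡ → ∄ (i , x≡) in
  trans (cong (π ⟨$⟩ˡ_) (flip-moves π πx)) (trans (flip-moves π πx) (sym πx))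
... | yes (i , refl) = trans (cong (π ⟨$⟩ˡ_) (flip-moves π (back₁ i)))
  (trans (flip-moves π (back₂ i)) (sym (step i)))
  where
  back₁ : ∀ i → π ⟨$⟩ʳ a (next (next i)) ≡ a i
  back₁ 0F = step 2F
  back₁ 1F = step 0F
  back₁ 2F = step 1F

  back₂ : ∀ i → π ⟨$⟩ʳ a (next i) ≡ a (next (next i))
  back₂ i = step (next i)

-- Agreement with a 3-cycle at two points

-- Pigeonhole: if every point were in `xs`, taking positions would inject `Fin n` into the positions
-- of a shorter list.
fresh : (xs : List (Fin n)) → length xs < n → ∃[ w ] w ∉ xs
fresh {n} xs len< = ¬∀⟶∃¬ n (_∈ xs) (λ w → _∈?_ _≟_ w xs) λ all∈ →
  ≤⇒≯ (injective⇒≤ {f = λ w → Any.index (all∈ w)}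
        (λ {w} {w′} → index-injective (setoid _) (all∈ w) (all∈ w′))) len<

less : Fin n → Fin n → ℕ
less i j = if does (i <? j) then 1 else 0

less-total : {i j : Fin n} → i ≢ j → less i j + less j i ≡ 1
less-total {i = i} {j} i≢j with <-cmp i j
... | tri≈ _ i≡j _    = contradiction i≡j i≢j
... | tri< i<j _ j≮i rewrite dec-true (i <? j) i<j | dec-false (j <? i) j≮i = refl
... | tri> i≮j _ j<i rewrite dec-false (i <? j) i≮j | dec-true (j <? i) j<i = refl

sum-ones : ∀ n → sum {n} (λ _ → 1) ≡ n
sum-ones zero    = refl
sum-ones (suc n) = cong suc (sum-ones n)

-- π exchanges the points with i < π i and those with π i < i.
fixed-point-free-involution : (π : Permutation′ n) → (∀ i → π ⟨$⟩ʳ i ≢ i) →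
  (∀ i → π ⟨$⟩ʳ (π ⟨$⟩ʳ i) ≡ i) → parity n ≡ 0ℙ
fixed-point-free-involution {n} π free inv = begin
  parity n              ≡⟨ cong parity s+s≡n ⟨
  parity (s + s)        ≡⟨ +-homo-+ s s ⟩
  parity s ℙ.+ parity s ≡⟨ p+p≡0ℙ (parity s) ⟩
  0ℙ                    ∎
  where
  open ≡-Reasoning
  up down : Fin n → ℕ
  up   i = less i (π ⟨$⟩ʳ i)
  down i = less (π ⟨$⟩ʳ i) i
  s = sum up

  s+s≡n : s + s ≡ n
  s+s≡n = begin
    s + s                         ≡⟨ cong (s +_) (sum-permute up π) ⟩
    s + sum (up ∘ (π ⟨$⟩ʳ_))      ≡⟨ cong (s +_) (sum-cong-≗ λ i → cong (less (π ⟨$⟩ʳ i)) (inv i)) ⟩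
    s + sum down                  ≡⟨ ∑-distrib-+ up down ⟨
    sum (λ i → up i + down i)     ≡⟨ sum-cong-≗ (λ i → less-total (free i ∘ sym)) ⟩
    sum {n} (λ _ → 1)             ≡⟨ sum-ones n ⟩
    n                             ∎

-- Agreement is with the inverse of `π`, so that the 3-cycle followed by `π` fixes both `x` and `y`.
fix-two : 5 ≤ n → parity n ≡ 1ℙ → (π : Permutation′ n) →
  ∃[ a ] ∃[ b ] ∃[ c ] a ≢ b × b ≢ c × c ≢ a ×
  ∃[ x ] ∃[ y ] x ≢ y × threeCycle a b c ⟨$⟩ʳ x ≡ π ⟨$⟩ˡ x × threeCycle a b c ⟨$⟩ʳ y ≡ π ⟨$⟩ˡ y
fix-two {n} 5≤n odd π with any? (λ x → π ⟨$⟩ˡ x ≟ x)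
... | yes (x , πx≡x)
  with y , y∉ ← fresh (x ∷ []) (≤-trans (m≤m+n 2 3) 5≤n)
  with π ⟨$⟩ˡ y ≟ y
-- Two fixed points: any 3-cycle on three other points also fixes them, which is where five points
-- are needed.
... | yes πy≡y
  with a , a∉ ← fresh (x ∷ y ∷ []) (≤-trans (m≤m+n 3 2) 5≤n)
  with b , b∉ ← fresh (a ∷ x ∷ y ∷ []) (≤-trans (m≤m+n 4 1) 5≤n)
  with c , c∉ ← fresh (b ∷ a ∷ x ∷ y ∷ []) 5≤n
  = let a≢b = b∉ ∘ here ∘ sym
        b≢c = c∉ ∘ here ∘ sym
        c≢a = c∉ ∘ there ∘ here
    in a , b , c , a≢b , b≢c , c≢a , x , y , y∉ ∘ here ∘ sym
     , trans (threeCycle-fix a≢b b≢c c≢a x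
               (a∉ ∘ here ∘ sym) (b∉ ∘ there ∘ here ∘ sym)
               (c∉ ∘ there ∘ there ∘ here ∘ sym)) (sym πx≡x)
     , trans (threeCycle-fix a≢b b≢c c≢a y
               (a∉ ∘ there ∘ here ∘ sym) (b∉ ∘ there ∘ there ∘ here ∘ sym)
               (c∉ ∘ there ∘ there ∘ there ∘ here ∘ sym)) (sym πy≡y)
-- One fixed point `x` and one moved point `y`: follow `y` to its image and close the cycle with a
-- spare point, avoiding `x`.
... | no πy≢y
  with w , w∉ ← fresh (x ∷ y ∷ (π ⟨$⟩ˡ y) ∷ []) (≤-trans (m≤m+n 4 1) 5≤n)
  = let a≢b = πy≢y ∘ sym
        b≢c = w∉ ∘ there ∘ there ∘ here ∘ sym
        c≢a = w∉ ∘ there ∘ here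
        x≢y = y∉ ∘ here ∘ sym
    in y , π ⟨$⟩ˡ y , w , a≢b , b≢c , c≢a , x , y , x≢y
     , trans (threeCycle-fix a≢b b≢c c≢a x x≢y
               (λ x≡πy → x≢y (perm-injective (flip π) (trans πx≡x x≡πy)))
               (w∉ ∘ here ∘ sym)) (sym πx≡x)
     , threeCycle-a a≢b b≢c c≢a
fix-two {n} 5≤n odd π | no free with any? (λ x → ¬? (π ⟨$⟩ˡ (π ⟨$⟩ˡ x) ≟ x))
-- No fixed point, but some `x` does not return after two steps: its first three iterates are
-- distinct and form the cycle.
... | yes (x , ππx≢x) =
  let q = π ⟨$⟩ˡ_
      a≢b = λ x≡qx → free (x , sym x≡qx)
      b≢c = λ qx≡qqx → free (q x , sym qx≡qqx)
  in x , q x , q (q x) , a≢b , b≢c , ππx≢x , x , q x , a≢b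
   , threeCycle-a a≢b b≢c ππx≢x , threeCycle-b a≢b b≢c ππx≢x
-- What remains is an involution without fixed points, which would pair off an odd number of points.
... | no inv = contradiction
  (trans (sym (fixed-point-free-involution (flip π) (λ i πi≡i → free (i , πi≡i))
    λ i → decidable-stable (_ ≟ _) λ ππi≢i → inv (i , ππi≢i))) odd) λ ()

-- Reduction by two points and one factor

extend-cycle : ∀ x → IsCycle l ρ → IsCycle l (extend {n} x ρ)
extend-cycle {ρ = ρ} x (a , a-inj , step , fix) =
    punchIn x ∘ a
  , a-inj ∘ punchIn-injective x _ _
  , (λ i → trans (extend-punched x ρ (a i)) (cong (punchIn x) (step i)))
  , λ y ∉ → fix′ y ∉
  where
  fix′ : ∀ y → (∀ i → y ≢ punchIn x (a i)) → extend x ρ ⟨$⟩ʳ y ≡ y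
  fix′ y ∉ with punchView x y
  ... | hole      = extend-hole x ρ
  ... | punched z = trans (extend-punched x ρ z)
    (cong (punchIn x) (fix z λ i z≡ → ∉ i (cong (punchIn x) z≡)))

-- `extend x` is a homomorphism taking `l`-cycles to `l`-cycles, so it can be applied factor by
-- factor.
extend-power : ∀ x → CyclePower k l n ρ → CyclePower k l (suc n) (extend x ρ)
extend-power {l = l} {n = n} {ρ = ρ} x (xs , cycles , prod≈) =
    Vec.map (extend x) xs
  , map⁺ cycles
  , λ i → trans (product-extend xs i) (sym (≈-extend (extend x ρ) (extend-hole x ρ)
      (λ j → trans (extend-punched x ρ j) (cong (punchIn x) (sym (prod≈ j)))) i))
  where
  map⁺ : ∀ {k} {xs : Vec (Permutation′ n) k} →
         VecAll.All (IsCycle l) xs → VecAll.All (IsCycle l) (Vec.map (extend x) xs)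
  map⁺ []       = []
  map⁺ (c ∷ cs) = extend-cycle x c ∷ map⁺ cs

  product-extend : ∀ {k} (xs : Vec (Permutation′ n) k) →
                   product (Vec.map (extend x) xs) ≈ extend x (product xs)
  product-extend []       = ≈-extend {x = x} {id} id refl λ _ → refl
  product-extend (τ ∷ xs) = ≈-extend (extend x τ ∘ₚ product (Vec.map (extend x) xs))
    (trans (product-extend xs _) (trans (cong (extend x (product xs) ⟨$⟩ʳ_) (extend-hole x τ))
      (extend-hole x (product xs))))
    λ i → trans (product-extend xs _) (trans (cong (extend x (product xs) ⟨$⟩ʳ_) (extend-punched x τ i))
            (extend-punched x (product xs) _))

CyclePower-resp-≈ : π ≈ ρ → CyclePower k l n π → CyclePower k l n ρ
CyclePower-resp-≈ π≈ρ (xs , cycles , prod≈) = xs , cycles , λ i → trans (prod≈ i) (π≈ρ i)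

cycle-∷ : IsCycle l π → CyclePower k l n ρ → CyclePower (suc k) l n (π ∘ₚ ρ)
cycle-∷ {π = π} c (xs , cycles , prod≈) = π ∷ xs , c ∷ cycles , λ i → prod≈ _

-- The 3-cycle `τ` from `fix-two`, followed by `π`, fixes `x` and `y` and is still even. Deleting
-- both points leaves `ρ`; a factorisation of `ρ` extends back, and putting the inverse of `τ` in
-- front recovers `π` at the cost of one factor.
reduce : 3 ≤ n → parity n ≡ 1ℙ → (π : Permutation′ (2 + n)) → HasSign 0ℙ π →
  ∃[ ρ ] HasSign {n} 0ℙ ρ × (∀ {k} → CyclePower k 3 n ρ → CyclePower (suc k) 3 (2 + n) π)
reduce {n} 3≤n odd π even
  with a , b , c , a≢b , b≢c , c≢a , x , y , x≢y , cx , cy ← fix-two (s≤s (s≤s 3≤n)) odd π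
  with punchView x y
... | hole       = contradiction refl x≢y
... | punched y′
  with ρ₁ , even₁ , σ≈₁ ← restrict x
         (swap {π = threeCycle a b c ∘ₚ π} a≢b
           (swap {π = transpose a c ∘ₚ π} (c≢a ∘ sym) even λ _ → refl) λ _ → refl)
         (trans (cong (π ⟨$⟩ʳ_) cx) (inverseʳ π))
  -- `y′` is the point `y` as numbered after the deletion of `x`.
  with ρ₂ , even₂ , ρ₁≈ ← restrict y′ even₁ (punchIn-injective x _ _
         (trans (sym (extend-punched x ρ₁ y′)) (trans (sym (σ≈₁ _))
           (trans (cong (π ⟨$⟩ʳ_) cy) (inverseʳ π)))))
  = ρ₂ , even₂ , λ power →
      CyclePower-resp-≈ {π = flip τ ∘ₚ extend x ρ₁} {ρ = π}
        (λ i → trans (sym (σ≈₁ _)) (cong (π ⟨$⟩ʳ_) (inverseʳ τ)))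
        (cycle-∷ {π = flip τ} {ρ = extend x ρ₁} (flip-cycle₃ τ (threeCycle-isCycle a≢b b≢c c≢a))
          (extend-power {ρ = ρ₁} x (CyclePower-resp-≈ {π = extend y′ ρ₂} {ρ = ρ₁} (sym ∘ ρ₁≈)
            (extend-power {ρ = ρ₂} y′ power))))
  where
  τ = threeCycle a b c

-- Small cases and the lower bound

sign₂ : Parity → Permutation′ 2
sign₂ 0ℙ = id
sign₂ 1ℙ = transpose 0F 1F

-- Both parities are treated, because the induction on the factorisation alternates between them.
even-Fin2 : {π : Permutation′ 2} → HasSign p π → π ≈ sign₂ p
even-Fin2 (even-id π≈) = π≈
even-Fin2 (swap {p = p} {i = i} {j} i≢j s π≈) k =
  trans (π≈ k) (trans (even-Fin2 s _) (go p i j k i≢j))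
  where
  go : ∀ p i j k → i ≢ j → sign₂ p ⟨$⟩ʳ PC.transpose i j k ≡ sign₂ (p ⁻¹) ⟨$⟩ʳ k
  go p 0F 0F k i≢j = contradiction refl i≢j
  go p 1F 1F k i≢j = contradiction refl i≢j
  go 0ℙ 0F 1F 0F _ = refl
  go 0ℙ 0F 1F 1F _ = refl
  go 0ℙ 1F 0F 0F _ = refl
  go 0ℙ 1F 0F 1F _ = refl
  go 1ℙ 0F 1F 0F _ = refl
  go 1ℙ 0F 1F 1F _ = refl
  go 1ℙ 1F 0F 0F _ = refl
  go 1ℙ 1F 0F 1F _ = refl

-- Deleting a fixed point leaves an even permutation of two points, which is the identity. Without
-- fixed points, injectivity leaves only the two 3-cycles among the possible values.
even-Fin3 : (π : Permutation′ 3) → HasSign 0ℙ π → π ≈ id ⊎ IsCycle 3 π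
even-Fin3 π even with any? (λ x → π ⟨$⟩ʳ x ≟ x)
... | yes (x , πx≡x) with ρ , even′ , π≈ ← restrict x even πx≡x
  = inj₁ λ i → trans (π≈ i) (sym (≈-extend id refl
      (λ j → cong (punchIn x) (sym (even-Fin2 even′ j))) i))
... | no free = inj₂ (derangement (λ {i} πi≡i → free (i , πi≡i)) _ _ _ refl refl refl)
  where
  derangement : (∀ {i} → π ⟨$⟩ʳ i ≢ i) → ∀ a b c →
    π ⟨$⟩ʳ 0F ≡ a → π ⟨$⟩ʳ 1F ≡ b → π ⟨$⟩ʳ 2F ≡ c → IsCycle 3 π
  derangement free 0F _  _  π0 _  _  = contradiction π0 free
  derangement free _  1F _  _  π1 _  = contradiction π1 free
  derangement free _  _  2F _  _  π2 = contradiction π2 free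
  derangement free 1F 0F 0F _  π1 π2 = contradiction (perm-injective π (trans π1 (sym π2))) λ ()
  derangement free 1F 0F 1F π0 _  π2 = contradiction (perm-injective π (trans π0 (sym π2))) λ ()
  derangement free 1F 2F 0F π0 π1 π2 = isCycle₃ {π = π} {0F} {1F} {2F} (λ ()) (λ ()) (λ ()) π0 π1 π2
    λ { 0F 0≢ _ _ → contradiction refl 0≢
      ; 1F _ 1≢ _ → contradiction refl 1≢
      ; 2F _ _ 2≢ → contradiction refl 2≢ }
  derangement free 1F 2F 1F π0 _  π2 = contradiction (perm-injective π (trans π0 (sym π2))) λ ()
  derangement free 2F 0F 0F _  π1 π2 = contradiction (perm-injective π (trans π1 (sym π2))) λ ()
  derangement free 2F 0F 1F π0 π1 π2 = isCycle₃ {π = π} {0F} {2F} {1F} (λ ()) (λ ()) (λ ()) π0 π2 π1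
    λ { 0F 0≢ _ _ → contradiction refl 0≢
      ; 1F _ _ 1≢ → contradiction refl 1≢
      ; 2F _ 2≢ _ → contradiction refl 2≢ }
  derangement free 2F 2F _  π0 π1 _  = contradiction (perm-injective π (trans π0 (sym π1))) λ ()

identity-power : (π : Permutation′ n) → π ≈ id → CyclePower 0 l n π
identity-power π π≈id = [] , [] , sym ∘ π≈id

singleton-power : (π : Permutation′ n) → IsCycle l π → CyclePower 1 l n π
singleton-power π c = π ∷ [] , c ∷ [] , λ _ → refl

double-power : (π : Permutation′ n) → CyclePower 1 3 n π → CyclePower 2 3 n π
double-power π (τ ∷ [] , c ∷ [] , prod≈) =
  flip τ ∷ flip τ ∷ [] , flip-cycle₃ τ c ∷ flip-cycle₃ τ c ∷ [] ,
  λ i → trans (cycle₃-inverse² τ c i) (prod≈ i)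

parity-odd : ∀ j → parity (5 + j * 2) ≡ 1ℙ
parity-odd zero    = refl
parity-odd (suc j) = parity-odd j

-- With `k = 2 + j` factors the number of points is `2k + 1`, and `reduce` lowers both sides in
-- step. The induction starts at five points, which reduce to the three of `even-Fin3`.
even-power : ∀ j (π : Permutation′ (5 + j * 2)) → HasSign 0ℙ π → CyclePower (2 + j) 3 _ π
even-power zero π even with ρ , even′ , lift ← reduce ≤-refl refl π even with even-Fin3 ρ even′
-- Here one factor suffices, but exactly two are required: the 3-cycle becomes the square of its
-- inverse.
... | inj₁ ρ≈id  = double-power π (lift (identity-power ρ ρ≈id))
... | inj₂ cycle = lift (singleton-power ρ cycle)
even-power (suc j) π even
  with ρ , even′ , lift ← reduce (m≤m+n 3 (2 + j * 2)) (parity-odd j) π even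
  = lift (even-power j ρ even′)

-- Disconnected graphs and their labellings

-- Edge contraction: `j` is identified with `punchIn j i`, and the numbering closes up over `j`.
contract : Fin (suc n) → Fin n → Fin (suc n) → Fin n
contract j i x with j ≟ x
... | yes _   = i
... | no j≢x = punchOut j≢x

contract-hole : ∀ j (i : Fin n) → contract j i j ≡ i
contract-hole j i with j ≟ j
... | yes _   = refl
... | no j≢j = contradiction refl j≢j

contract-punchIn : ∀ j (i x : Fin n) → contract j i (punchIn j x) ≡ x
contract-punchIn j i x with j ≟ punchIn j x
... | yes j≡ = contradiction (sym j≡) (punchInᵢ≢i j x)
... | no j≢  = trans (punchOut-cong j refl) (punchOut-punchIn j)

-- Fewer than `n - 1` edges cannot connect `n` points. Contracting an edge removes one edge and one
-- point, so the bound persists until at least two points and no edges are left.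
nonconstant-labelling : (es : Vec (Fin n × Fin n) k) → 2 + k ≤ n →
  Σ[ f ∈ (Fin n → Bool) ] (∃[ u ] ∃[ v ] f u ≢ f v) × VecAll.All (λ (i , j) → f i ≡ f j) es
nonconstant-labelling [] (s≤s (s≤s (z≤n {m}))) = first , (0F , 1F , λ ()) , []
  where
  first : Fin (2 + m) → Bool
  first zero    = true
  first (suc _) = false
nonconstant-labelling ((i , j) ∷ es) (s≤s 2+k≤n) with punchView j i
-- A loop imposes no condition and is dropped.
... | hole with f , uv , es-ok ← nonconstant-labelling es (m≤n⇒m≤1+n 2+k≤n) = f , uv , refl ∷ es-ok
... | punched i′
  with f , (u , v , fu≢fv) , es-ok ← nonconstant-labelling
         (Vec.map (λ (a , b) → contract j i′ a , contract j i′ b) es) 2+k≤n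
  -- The labelling is pulled back along the contraction; `punchIn j` is a section of it and lifts
  -- the two separated points.
  = f ∘ contract j i′
  , (punchIn j u , punchIn j v , λ eq → fu≢fv
      (trans (cong f (sym (contract-punchIn j i′ u))) (trans eq (cong f (contract-punchIn j i′ v)))))
  , cong f (trans (contract-punchIn j i′ i′) (sym (contract-hole j i′)))
  ∷ VecAll.map⁻ es-ok

-- Labellings invariant under 3-cycles

Compatible : (Fin n → Bool) → Permutation′ n → Set
Compatible {n} f π = Σ[ (a , _) ∈ IsCycle 3 π ] (∀ i → f (a i) ≡ f (a (next i)))

-- Two edges already connect the three points of a cycle; the third equality of labels follows by
-- transitivity. Hence `k * 2` edges, not `k * 3`.
triple-edges : {xs : Vec (Permutation′ n) k} → VecAll.All (IsCycle 3) xs → Vec (Fin n × Fin n) (k * 2)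
triple-edges []                 = []
triple-edges ((a , _) ∷ cycles) = (a 0F , a 1F) ∷ (a 1F , a 2F) ∷ triple-edges cycles

edges-compatible : ∀ {f : Fin n → Bool} {xs : Vec (Permutation′ n) k}
  (cycles : VecAll.All (IsCycle 3) xs) →
  VecAll.All (λ (i , j) → f i ≡ f j) (triple-edges cycles) → VecAll.All (Compatible f) xs
edges-compatible [] _ = []
edges-compatible (cycle ∷ cycles) (f₀₁ ∷ f₁₂ ∷ es-ok) =
    (cycle , λ { 0F → f₀₁ ; 1F → f₁₂ ; 2F → trans (sym f₁₂) (sym f₀₁) })
    ∷ edges-compatible cycles es-ok

compatible-labelling : (xs : Vec (Permutation′ n) k) → VecAll.All (IsCycle 3) xs → 2 + k * 2 ≤ n →
  Σ[ f ∈ (Fin n → Bool) ] (∃[ u ] ∃[ v ] f u ≢ f v) × VecAll.All (Compatible f) xs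
compatible-labelling {n = n} xs cycles bound
  with f , uv , es-ok ← nonconstant-labelling (triple-edges cycles) bound
  = f , uv , edges-compatible cycles es-ok

compatible-invariant : ∀ {f : Fin n → Bool} → Compatible f π → ∀ x → f (π ⟨$⟩ʳ x) ≡ f x
compatible-invariant {f = f} ((a , _ , step , fix) , fa) x
  with any? {P = λ i → x ≡ a i} (λ i → x ≟ a i)
... | yes (i , refl) = trans (cong f (step i)) (sym (fa i))
... | no x∉a        = cong f (fix x λ i x≡ → x∉a (i , x≡))

product-invariant : ∀ {f : Fin n → Bool} {xs : Vec (Permutation′ n) k} → VecAll.All (Compatible f) xs →
                    ∀ x → f (product xs ⟨$⟩ʳ x) ≡ f x
product-invariant []                _ = refl
product-invariant {f = f} (_∷_ {x = τ} c cs) x =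
  trans (product-invariant {f = f} cs _) (compatible-invariant {π = τ} {f} c x)

-- A compatible 3-cycle moving x would have a third point in the class of x.
compatible-fix : ∀ {f : Fin n → Bool} {x y : Fin n} → (∀ w → f w ≡ f x → w ≡ x ⊎ w ≡ y) →
                 Compatible f π → π ⟨$⟩ʳ x ≡ x
compatible-fix {f = f} {x} {y} class ((a , a-inj , _ , fix) , fa)
  with any? {P = λ i → x ≡ a i} (λ i → x ≟ a i)
... | no x∉a        = fix x λ i x≡ → x∉a (i , x≡)
... | yes (i , refl) = contradiction (trans (eq₁ i class) (sym (eq₂ i class))) (a≢ (next i))
  where
  a≢ : ∀ i → a i ≢ a (next i)
  a≢ 0F = (λ ()) ∘ a-inj
  a≢ 1F = (λ ()) ∘ a-inj
  a≢ 2F = (λ ()) ∘ a-inj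

  next³ : ∀ i → a (next (next (next i))) ≡ a i
  next³ 0F = refl
  next³ 1F = refl
  next³ 2F = refl

  eq₁ : ∀ i → (∀ w → f w ≡ f (a i) → w ≡ a i ⊎ w ≡ y) → a (next i) ≡ y
  eq₁ i class with class (a (next i)) (sym (fa i))
  ... | inj₁ eq = contradiction (sym eq) (a≢ i)
  ... | inj₂ eq = eq

  eq₂ : ∀ i → (∀ w → f w ≡ f (a i) → w ≡ a i ⊎ w ≡ y) → a (next (next i)) ≡ y
  eq₂ i class with class (a (next (next i))) (trans (sym (fa (next i))) (sym (fa i)))
  ... | inj₁ eq = contradiction (trans eq (sym (next³ i))) (a≢ (next (next i)))
  ... | inj₂ eq = eq

product-fix : ∀ {x} {xs : Vec (Permutation′ n) k} → VecAll.All (λ π → π ⟨$⟩ʳ x ≡ x) xs →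
              product xs ⟨$⟩ʳ x ≡ x
product-fix []                             = refl
product-fix {xs = _ ∷ xs} (πx≡x ∷ fixed) = trans (cong (product xs ⟨$⟩ʳ_) πx≡x) (product-fix fixed)

-- Even permutations that are not products of few 3-cycles

-- The adjacent transpositions (0 1), (1 2), and so on, in this order. Their product is a cycle
-- through all `suc n` points that lowers each nonzero point by one, and it is even when `n` is.
path : ∀ n → TranspositionList (suc n)
path zero    = []
path (suc n) = (0F , 1F) ∷ lift₀ (path n)

Nondegenerate : TranspositionList n → Set
Nondegenerate = List.All (λ (i , j) → i ≢ j)

lift₀-nondegenerate : {ts : TranspositionList n} → Nondegenerate ts → Nondegenerate (lift₀ ts)
lift₀-nondegenerate = List.map⁺ ∘ List.map (_∘ suc-injective)

path-nondegenerate : ∀ n → Nondegenerate (path n)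
path-nondegenerate zero    = []
path-nondegenerate (suc n) = (λ ()) ∷ lift₀-nondegenerate (path-nondegenerate n)

length-path : ∀ n → length (path n) ≡ n
length-path zero    = refl
length-path (suc n) = cong suc (trans (length-map _ (path n)) (length-path n))

path-suc : ∀ n i → eval (path n) ⟨$⟩ʳ suc i ≡ inject₁ i
path-suc (suc n) zero    = eval-lift (path n) 0F
path-suc (suc n) (suc i) = trans (eval-lift (path n) (suc (suc i))) (cong suc (path-suc n i))

-- The cycle sends `suc i` to `i`, so invariance propagates the label of `0F` upwards.
path-invariant-constant : (f : Fin (suc n) → Bool) → (∀ x → f (eval (path n) ⟨$⟩ʳ x) ≡ f x) →
                          ∀ x → f x ≡ f 0F
path-invariant-constant {n} f inv = constant f λ i → trans (sym (inv (suc i))) (cong f (path-suc n i))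
  where
  constant : ∀ {n} (f : Fin (suc n) → Bool) → (∀ i → f (suc i) ≡ f (inject₁ i)) → ∀ x → f x ≡ f 0F
  constant f eq zero            = refl
  constant {suc _} f eq (suc i) = trans (constant (f ∘ suc) (eq ∘ suc) i) (eq 0F)

n-cycle-bound : ∀ n → CyclePower k 3 (suc n) (eval (path n)) → ¬ (2 + k * 2 ≤ suc n)
n-cycle-bound n (xs , cycles , prod≈) bound
  with f , (u , v , fu≢fv) , compat ← compatible-labelling xs cycles bound
  = fu≢fv (trans (constant u) (sym (constant v)))
  where
  constant = path-invariant-constant f λ x →
    trans (cong f (sym (prod≈ x))) (product-invariant compat x)

-- A full cycle on the points from `2F` on, next to the transposition of `0F` and `1F`. It uses
-- `suc n` transpositions, so it serves when `3 + n` is even.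
swap-path : ∀ n → TranspositionList (3 + n)
swap-path n = (0F , 1F) ∷ lift₀ (lift₀ (path n))

swap-path-tail : ∀ n x → eval (swap-path n) ⟨$⟩ʳ suc (suc x) ≡ suc (suc (eval (path n) ⟨$⟩ʳ x))
swap-path-tail n x = trans (eval-lift (lift₀ (path n)) (suc (suc x)))
  (cong suc (eval-lift (path n) (suc x)))

swap-path-0 : ∀ n → eval (swap-path n) ⟨$⟩ʳ 0F ≡ 1F
swap-path-0 n = trans (eval-lift (lift₀ (path n)) 1F) (cong suc (eval-lift (path n) 0F))

swap-path-bound : ∀ n → CyclePower k 3 (3 + n) (eval (swap-path n)) → ¬ (2 + k * 2 ≤ 3 + n)
swap-path-bound n (xs , cycles , prod≈) bound
  with f , (u , v , fu≢fv) , compat ← compatible-labelling xs cycles bound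
  -- The points labelled like `0F` are just `0F` and `1F`, so every factor fixes `0F`, whereas the
  -- product sends it to `1F`.
  = contradiction (trans (sym (swap-path-0 n)) (trans (sym (prod≈ 0F)) (product-fix
      (VecAll.map (λ {τ} → compatible-fix {π = τ} class) compat)))) λ ()
  where
  inv : ∀ x → f (eval (swap-path n) ⟨$⟩ʳ x) ≡ f x
  inv x = trans (cong f (sym (prod≈ x))) (product-invariant compat x)

  f1≡f0 : f 1F ≡ f 0F
  f1≡f0 = trans (cong f (sym (swap-path-0 n))) (inv 0F)

  tail-constant : ∀ x → f (suc (suc x)) ≡ f 2F
  tail-constant = path-invariant-constant (λ x → f (suc (suc x))) λ x →
    trans (cong f (sym (swap-path-tail n x))) (inv (suc (suc x)))

  f2≢f0 : f 2F ≢ f 0F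
  f2≢f0 f2≡f0 = fu≢fv (trans (constant u) (sym (constant v)))
    where
    constant : ∀ x → f x ≡ f 0F
    constant 0F            = refl
    constant 1F            = f1≡f0
    constant (suc (suc x)) = trans (tail-constant x) f2≡f0

  class : ∀ w → f w ≡ f 0F → w ≡ 0F ⊎ w ≡ 1F
  class 0F            _     = inj₁ refl
  class 1F            _     = inj₂ refl
  class (suc (suc x)) fx≡f0 = contradiction (trans (sym (tail-constant x)) fx≡f0) f2≢f0

-- The upper bound and the conclusion

2∣n⊎2∣1+n : ∀ n → 2 ∣ n ⊎ 2 ∣ suc n
2∣n⊎2∣1+n zero    = inj₁ (divides 0 refl)
2∣n⊎2∣1+n (suc n) with 2∣n⊎2∣1+n n
... | inj₁ 2∣n   = inj₂ (∣m∣n⇒∣m+n ∣-refl 2∣n)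
... | inj₂ 2∣1+n = inj₁ 2∣1+n

cycle-power-bound : ∀ k n → 2 ≤ k → (∀ π → Alternating n π → CyclePower k 3 n π) → ¬ (2 + k * 2 ≤ n)
-- From `2 ≤ k` comes `6 ≤ n`, so `n` has the form `3 + m` that `swap-path` requires. The parity of
-- `m` decides which of the two witnesses is an even permutation.
cycle-power-bound k n 2≤k all-powers bound with ≤-trans (s≤s (s≤s (*-monoˡ-≤ 2 2≤k))) bound
... | s≤s (s≤s (s≤s {n = m} _)) with 2∣n⊎2∣1+n m
...   | inj₁ 2∣m   = n-cycle-bound (2 + m) (all-powers (eval (path (2 + m)))
  (path (2 + m) , path-nondegenerate (2 + m) ,
   subst (2 ∣_) (sym (length-path (2 + m))) (∣m∣n⇒∣m+n ∣-refl 2∣m) , λ _ → refl)) bound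
...   | inj₂ 2∣1+m = swap-path-bound m (all-powers (eval (swap-path m))
  (swap-path m , (λ ()) ∷ lift₀-nondegenerate (lift₀-nondegenerate (path-nondegenerate m)) ,
   subst (2 ∣_) (cong suc (sym length-lift²)) 2∣1+m , λ _ → refl)) bound
  where
  length-lift² : length (lift₀ (lift₀ (path m))) ≡ m
  length-lift² = trans (length-map _ (lift₀ (path m))) (trans (length-map _ (path m)) (length-path m))

theoremA : (k : ℕ) → 2 ≤ k → n⟨ k , 3 ⟩≡ (2 * k + 1)
theoremA k@(suc (suc j)) 2≤k@(s≤s (s≤s z≤n)) =
  (λ {π} → lower π) , λ n P → largest n λ π → P {π}
  where
  1+k*2≡2*k+1 : 1 + k * 2 ≡ 2 * k + 1
  1+k*2≡2*k+1 = trans (cong suc (*-comm k 2)) (+-comm 1 (2 * k))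

  lower : ∀ π → Alternating (2 * k + 1) π → CyclePower k 3 (2 * k + 1) π
  lower = subst (λ n → ∀ π → Alternating n π → CyclePower k 3 n π) 1+k*2≡2*k+1
    -- `1 + k * 2` computes to `5 + j * 2`, the number of points in `even-power`.
    λ π alt → even-power j π (Alternating⇒even {π = π} alt)

  largest : ∀ n → (∀ π → Alternating n π → CyclePower k 3 n π) → n ≤ 2 * k + 1
  largest n all-powers = decidable-stable (n ≤? 2 * k + 1) λ n≰ →
    cycle-power-bound k n 2≤k all-powers (≤-trans (≤-reflexive (cong suc 1+k*2≡2*k+1)) (≰⇒> n≰))
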